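{- Let $H$ be one of the following graphs: $4K_1$, the co-diamond, the co-claw. Then for every integer $p\ge 1$ there exist a positive integer $k$ and a $k$-colorable $(2K_2, H)$-free graph $G$ that is not $(k+p)$-mixing.
   Context: All graphs are finite and simple. A $k$-coloring of $G$ is a map $V(G)\to\{1,\dots,k\}$ giving adjacent vertices different values; $G$ is $k$-colorable if it has a $k$-coloring. $R_k(G)$ denotes the graph whose vertices are the $k$-colorings of $G$, two being adjacent if they differ in color on exactly one vertex. $G$ is $\ell$-mixing if $R_\ell(G)$ is connected. A graph is $(H_1,\dots,H_r)$-free if it has no induced subgraph isomorphic to any $H_i$. $2K_2$ is the disjoint union of two edges; $4K_1$ is the edgeless graph on 4 vertices; the co-diamond is $K_2+2K_1$ (4 vertices, one edge); the co-claw is $K_3+K_1$ (disjoint union of a triangle and a single vertex). -}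

module Defs where

open import Data.Empty using (⊥)
open import Data.Fin.Base using (Fin; splitAt)
open import Data.Fin.Properties using (_≟_; any?; all?)
open import Data.Fin.Subset using (Subset; _∈_)
open import Data.Nat.Base using (ℕ; _+_)
open import Data.Product.Base using (∃-syntax; _×_; _,_; proj₁)
open import Data.Product using (∃!)
open import Data.Sum.Base using (_⊎_; inj₁; inj₂)
open import Data.Sum.Relation.Binary.Pointwise
  using (Pointwise; inj₁; inj₂; ⊎-symmetric; ⊎-decidable)
open import Data.Vec.Base using (Vec; lookup)
open import Function.Base using (_on_)
open import Function.Bundles using (_↔_; _⇔_; Inverse)
open import Level using (0ℓ)
open import Relation.Binary.Construct.Closure.ReflexiveTransitive using (Star)
open import Relation.Binary.Core using (Rel)
open import Relation.Binary.Definitions using (Symmetric; Irreflexive; Decidable)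
open import Relation.Binary.PropositionalEquality
  using (_≡_; _≢_; refl; cong; ≢-sym)
open import Relation.Nullary.Decidable using (no; ¬?; _×-dec_; _→-dec_; map′)
open import Relation.Nullary.Negation using (¬_)

record SimpleGraph (V : Set) : Set₁ where
  field
    Adj    : Rel V 0ℓ
    symm   : Symmetric Adj
    irrefl : Irreflexive _≡_ Adj
    adj?   : Decidable Adj

open SimpleGraph public

FiniteGraph : ℕ → Set₁
FiniteGraph n = SimpleGraph (Fin n)

pullback : {V W : Set} → (V → W) → SimpleGraph W → SimpleGraph V
pullback f G .Adj          = Adj G on f
pullback f G .symm         = symm G
pullback f G .irrefl u≡v   = irrefl G (cong f u≡v)
pullback f G .adj? u v     = adj? G (f u) (f v)

record _≅_ {V W : Set} (G : SimpleGraph V) (H : SimpleGraph W) : Set where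
  field
    bijection : V ↔ W
    adjacency : ∀ u v →
      Adj G u v ⇔ Adj H (Inverse.to bijection u) (Inverse.to bijection v)

induced : ∀ {n} → FiniteGraph n → (S : Subset n) → SimpleGraph (∃[ v ] v ∈ S)
induced G S = pullback proj₁ G

_-Free_ : ∀ {m n} → FiniteGraph m → FiniteGraph n → Set
H -Free G = ¬ (∃[ S ] induced G S ≅ H)

Connected : {V : Set} → SimpleGraph V → Set
Connected G = ∀ u v → Star (Adj G) u v

complete : ∀ n → FiniteGraph n
complete n .Adj          = _≢_
complete n .symm         = ≢-sym
complete n .irrefl u≡v f = f u≡v
complete n .adj? u v     = ¬? (u ≟ v)

edgeless : ∀ n → FiniteGraph n
edgeless n .Adj _ _   = ⊥
edgeless n .symm ()
edgeless n .irrefl _ ()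
edgeless n .adj? _ _  = no λ ()

disjointUnion : {V W : Set} → SimpleGraph V → SimpleGraph W → SimpleGraph (V ⊎ W)
disjointUnion G H .Adj                  = Pointwise (Adj G) (Adj H)
disjointUnion G H .symm                 = ⊎-symmetric (symm G) (symm H)
disjointUnion G H .irrefl refl (inj₁ a) = irrefl G refl a
disjointUnion G H .irrefl refl (inj₂ a) = irrefl H refl a
disjointUnion G H .adj?                 = ⊎-decidable (adj? G) (adj? H)

infixl 6 _⊕_

_⊕_ : ∀ {m n} → FiniteGraph m → FiniteGraph n → FiniteGraph (m + n)
_⊕_ {m} G H = pullback (splitAt m) (disjointUnion G H)

2K₂ 4K₁ co-diamond co-claw : FiniteGraph 4
2K₂        = complete 2 ⊕ complete 2
4K₁        = edgeless 4
co-diamond = complete 2 ⊕ edgeless 2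
co-claw    = complete 3 ⊕ complete 1

-- The map is stored as a vector and its properness is irrelevant, so that two
-- colorings are propositionally equal as soon as they agree on every vertex.
-- With functions in place of vectors, the reflexive case of Star could fail
-- to relate pointwise equal colorings.
record Coloring {n} (G : FiniteGraph n) (k : ℕ) : Set where
  field
    colors  : Vec (Fin k) n
    .proper : ∀ {u v} → Adj G u v → lookup colors u ≢ lookup colors v

  color : Fin n → Fin k
  color = lookup colors

open Coloring public using (colors; color)

_-Colorable_ : ∀ {n} → ℕ → FiniteGraph n → Set
k -Colorable G = Coloring G k

Reconfiguration : ∀ {n} (k : ℕ) (G : FiniteGraph n) → SimpleGraph (Coloring G k)
Reconfiguration k G .Adj c d = ∃! _≡_ λ v → color c v ≢ color d v
Reconfiguration k G .symm (v , c≢d , unique) =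
  v , ≢-sym c≢d , λ d≢c → unique (≢-sym d≢c)
Reconfiguration k G .irrefl refl (v , c≢c , _) = c≢c refl
Reconfiguration k G .adj? c d =
  any? λ v → differ? v ×-dec
    map′ (λ f {w} → f w) (λ f w → f) (all? λ w → differ? w →-dec (v ≟ w))
  where differ? = λ v → ¬? (color c v ≟ color d v)

_-Mixing_ : ∀ {n} → ℕ → FiniteGraph n → Set
ℓ -Mixing G = Connected (Reconfiguration ℓ G)

{-# OPTIONS --safe #-}

-- The complement of G is the graph of flags (incident vertex-edge pairs) of p
-- disjoint copies of K₄, two flags being joined if they share their vertex or
-- their edge; for one copy this is the truncated tetrahedron. Among any three
-- leaves of a claw two share the same kind of element with its centre, and the
-- simplicity and 3-regularity of pK₄ exclude C₄, the diamond and K₄ as well.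
-- Naming a flag by its vertex colors G with 4p ≤ 5p colors. Naming it by its
-- edge is a 6p-coloring which is frozen: every edge has an end different from a
-- given vertex, so every flag has a G-neighbour in every other color class.
-- Hence G is not (5p + p)-mixing.

module Submission where

open import Defs
open import Data.Empty using (⊥; ⊥-elim; ⊥-elim-irr)
open import Data.Fin.Base using (Fin; inject≤; combine; remQuot; quotient; remainder)
open import Data.Fin.Patterns using (0F; 1F; 2F; 3F; 4F; 5F)
open import Data.Fin.Properties
  using (_≟_; any?; all?; pigeonhole; <⇒≢; inject≤-injective;
         combine-injective; combine-remQuot; remQuot-combine)
open import Data.Fin.Subset using () renaming (_∈_ to _∈ˢ_)
open import Data.List.Base using (_∷_; [])
open import Data.List.Membership.Propositional using (_∈_)
open import Data.List.Relation.Unary.Any using (here; there)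
open import Data.Nat.Base using (ℕ; suc; _+_; _*_; _≤_; _≥_; s≤s; z≤n)
open import Data.Nat.Properties using (*-suc; *-monoʳ-≤; m≤m+n; +-comm; n<1+n; n≤1+n)
open import Data.Product.Base using (∃-syntax; Σ-syntax; _×_; _,_; proj₁; proj₂)
open import Data.Sum.Base as Sum using (_⊎_; inj₁; inj₂; swap)
open import Data.Vec.Base using (_∷_; []; lookup; tabulate)
open import Data.Vec.Properties using (lookup∘tabulate)
open import Data.Vec.Properties.WithK using ([]=-irrelevant)
open import Function.Base using (_∘_; case_of_)
open import Function.Bundles using (Equivalence; Inverse)
open import Function.Definitions using (Injective)
open import Relation.Binary.Construct.Closure.ReflexiveTransitive using (ε; _◅_)
open import Relation.Binary.PropositionalEquality
  using (_≡_; _≢_; refl; sym; trans; cong; cong₂; subst; ≢-sym; module ≡-Reasoning)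
open import Relation.Nullary.Decidable
  using (Dec; yes; no; ¬?; _×-dec_; _⊎-dec_; _→-dec_; from-yes; from-no; decidable-stable)
open import Relation.Nullary.Negation using (¬_)

-- Induced copies as embeddings

record _↪_ {V W : Set} (H : SimpleGraph V) (G : SimpleGraph W) : Set where
  field
    map       : V → W
    injective : Injective _≡_ _≡_ map
    preserve  : ∀ {i j} → Adj H i j → Adj G (map i) (map j)
    reflect   : ∀ {i j} → Adj G (map i) (map j) → Adj H i j

open _↪_

-- The inverse of an isomorphism onto `H`, followed by the inclusion of the induced subgraph, is an
-- embedding. Its injectivity uses that membership proofs in `S` are unique.
↪-free : ∀ {m n} {H : FiniteGraph m} {G : FiniteGraph n} → ¬ (H ↪ G) → H -Free G
↪-free {H = H} {G} no-copy (S , iso) = no-copy record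
  { map       = proj₁ ∘ from
  ; injective = λ {i} {j} eq →
      trans (sym (to-from i)) (trans (cong to (∈-unique eq)) (to-from j))
  ; preserve  = λ {i} {j} a → Equivalence.from (adjacency (from i) (from j))
      (transport (sym (to-from i)) (sym (to-from j)) a)
  ; reflect   = λ {i} {j} a → transport (to-from i) (to-from j)
      (Equivalence.to (adjacency (from i) (from j)) a)
  }
  where
  open _≅_ iso
  open Inverse bijection using (to; from; strictlyInverseˡ)

  to-from : ∀ i → to (from i) ≡ i
  to-from = strictlyInverseˡ

  transport : ∀ {i j i′ j′} → i ≡ i′ → j ≡ j′ → Adj H i j → Adj H i′ j′
  transport refl refl a = a

  ∈-unique : {x y : ∃[ v ] v ∈ˢ S} → proj₁ x ≡ proj₁ y → x ≡ y
  ∈-unique {v , p} {_ , q} refl = cong (v ,_) ([]=-irrelevant p q)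

-- Frozen colorings

module _ {n : ℕ} {G : FiniteGraph n} where

  coloring : ∀ {k} (f : Fin n → Fin k) → (∀ {u v} → Adj G u v → f u ≢ f v) → Coloring G k
  coloring f proper = record
    { colors = tabulate f
    ; proper = λ {u} {v} a eq → proper a
        (trans (sym (lookup∘tabulate f u)) (trans eq (lookup∘tabulate f v)))
    }

  Frozen : ∀ {k} → Coloring G k → Set
  Frozen c = ∀ v e → e ≢ color c v → ∃[ u ] (Adj G v u × color c u ≡ e)

  -- Let `v` be the only recolored vertex and `u` a neighbour of `v` that has under `c` the new
  -- color of `v`. If `u` keeps its color, `d` is not proper on `vu`; if not, uniqueness gives
  -- `v ≡ u`, a loop.
  frozen-isolated : ∀ {k} {c d : Coloring G k} → Frozen c → ¬ Adj (Reconfiguration k G) c d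
  frozen-isolated {c = c} {d@(record { proper = proper })} frozen (v , cv≢dv , unique)
    with u , vu , cu≡dv ← frozen v (color d v) (≢-sym cv≢dv)
    with color c u ≟ color d u
  ... | yes cu≡du = ⊥-elim-irr (proper vu (trans (sym cu≡dv) cu≡du))
  ... | no  cu≢du = irrefl G (unique cu≢du) vu

  frozen-not-mixing : ∀ {k} {c d : Coloring G k} → Frozen c → c ≢ d → ¬ (k -Mixing G)
  frozen-not-mixing {c = c} {d} frozen c≢d mixing with mixing c d
  ... | ε                  = c≢d refl
  ... | _◅_ {j = c′} cc′ _ = frozen-isolated {c = c} {d = c′} frozen cc′

-- Flags and their sharing relation

agree-across : {V A B : Set} {f : V → A} {g : V → B} →
  (∀ {u v} → f u ≡ f v → g u ≡ g v → u ≡ v) →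
  ∀ {a b c} → f a ≡ f b → a ≢ b →
  f a ≡ f c ⊎ g a ≡ g c → f b ≡ f c ⊎ g b ≡ g c → f a ≡ f c
agree-across inj ab a≢b (inj₁ ac) _         = ac
agree-across inj ab a≢b (inj₂ _)  (inj₁ bc) = trans ab bc
-- If `c` met both `a` and `b` through `g`, these two would agree under `g` as well as `f` and hence
-- coincide.
agree-across inj ab a≢b (inj₂ ac) (inj₂ bc) = ⊥-elim (a≢b (inj ab (trans ac (sym bc))))

-- The flags of a simple graph with k vertices, ℓ edges and all degrees at most 3.
record Flags (n k ℓ : ℕ) : Set where
  field
    vertex : Fin n → Fin k
    edge   : Fin n → Fin ℓ
    rank   : Fin n → Fin 3
    flag-injective : ∀ {a b} → vertex a ≡ vertex b → edge a ≡ edge b → a ≡ b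
    rank-injective : ∀ {a b} → vertex a ≡ vertex b → rank a ≡ rank b → a ≡ b
    two-ends       : ∀ {a b c} → edge a ≡ edge b → edge a ≡ edge c →
                     a ≡ b ⊎ a ≡ c ⊎ b ≡ c
    -- Simplicity: the edge of `b` and `c` and the edge of `d` and `a` join the same two vertices,
    -- so they are not parallel edges.
    no-digon       : ∀ {a b c d} → vertex a ≡ vertex b → edge b ≡ edge c →
                     vertex c ≡ vertex d → edge d ≡ edge a → a ≡ b ⊎ vertex a ≡ vertex c
    other-end      : ∀ a e → ∃[ u ] (edge u ≡ e × vertex u ≢ vertex a)

module FlagGraph {n k ℓ} (F : Flags n k ℓ) where
  open Flags F

  Share : Fin n → Fin n → Set
  Share u v = vertex u ≡ vertex v ⊎ edge u ≡ edge v

  share-sym : ∀ {u v} → Share u v → Share v u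
  share-sym = Sum.map sym sym

  share? : ∀ u v → Dec (Share u v)
  share? u v = (vertex u ≟ vertex v) ⊎-dec (edge u ≟ edge v)

  graph : FiniteGraph n
  graph .Adj u v           = ¬ Share u v
  graph .symm uv           = uv ∘ share-sym
  graph .irrefl refl uu    = uu (inj₁ refl)
  graph .adj? u v          = ¬? (share? u v)

  module _ {H : FiniteGraph 4} (f : H ↪ graph) where

    share : ∀ i j → ¬ Adj H i j → Share (map f i) (map f j)
    -- Adjacency is the negation of sharing, so a non-edge yields sharing by decidability.
    share i j ¬ij = decidable-stable (share? _ _) (¬ij ∘ reflect f)

    distinct : ∀ {i j} → i ≢ j → map f i ≢ map f j
    distinct i≢j = i≢j ∘ injective f

  -- Along an induced path of the complement the kind of the shared element alternates: two
  -- consecutive steps of the same kind would make the outer flags share.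
  edge-next : ∀ {a b c} → Adj graph a c → vertex a ≡ vertex b → Share b c → edge b ≡ edge c
  edge-next ac ab (inj₁ bc) = ⊥-elim (ac (inj₁ (trans ab bc)))
  edge-next ac ab (inj₂ bc) = bc

  vertex-next : ∀ {a b c} → Adj graph a c → edge a ≡ edge b → Share b c → vertex b ≡ vertex c
  vertex-next ac ab (inj₁ bc) = bc
  vertex-next ac ab (inj₂ bc) = ⊥-elim (ac (inj₂ (trans ab bc)))

  -- The complement of `2K₂` is a four-cycle. Alternation around it produces two edges of the
  -- underlying graph with the same ends, and either outcome of `no-digon` makes a diagonal share.
  no-alternating-square : ∀ {a b c d} → Adj graph a c → Adj graph b d →
    vertex a ≡ vertex b → Share b c → Share c d → Share d a → ⊥
  no-alternating-square ac bd ab b~c c~d d~a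
    with bc ← edge-next ac ab b~c
    with cd ← vertex-next bd bc c~d
    with da ← edge-next (symm graph ac) cd d~a
    with no-digon ab bc cd da
  ... | inj₁ a≡b = bd (inj₂ (trans (cong edge (sym a≡b)) (sym da)))
  ... | inj₂ ac′ = ac (inj₁ ac′)

  2K₂-free : 2K₂ -Free graph
  2K₂-free = ↪-free λ f →
    contradict (preserve f (from-yes (adj? 2K₂ 0F 1F)))
      (preserve f (from-yes (adj? 2K₂ 2F 3F)))
      (share f 0F 2F (from-no (adj? 2K₂ 0F 2F)))
      (share f 0F 3F (from-no (adj? 2K₂ 0F 3F)))
      (share f 1F 2F (from-no (adj? 2K₂ 1F 2F)))
      (share f 1F 3F (from-no (adj? 2K₂ 1F 3F)))
    where
    contradict : ∀ {w x y z} → Adj graph w x → Adj graph y z →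
      Share w y → Share w z → Share x y → Share x z → ⊥
    contradict wx yz (inj₁ wy) wz xy xz =
      no-alternating-square wx yz wy (share-sym xy) xz (share-sym wz)
    -- The square must start with a shared vertex, so it is traversed in the other direction, from
    -- `w` to `z`.
    contradict wx yz (inj₂ wy) wz xy xz =
      no-alternating-square wx (symm graph yz)
        (vertex-next yz (sym wy) wz) (share-sym xz) xy (inj₂ (sym wy))

  -- Whatever the first two flags share passes to the others: four flags at one vertex exceed the
  -- three ranks, and three flags on one edge exceed its two ends.
  4K₁-free : 4K₁ -Free graph
  4K₁-free = ↪-free λ f →
    let near : ∀ i j → Share (map f i) (map f j)
        near i j = share f i j (λ ())

        same-vertex : vertex (map f 0F) ≡ vertex (map f 1F) →
                      ∀ i → vertex (map f 0F) ≡ vertex (map f i)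
        same-vertex eq i = agree-across flag-injective eq (distinct f λ ()) (near 0F i) (near 1F i)

        same-edge : edge (map f 0F) ≡ edge (map f 1F) →
                    edge (map f 0F) ≡ edge (map f 2F)
        -- The roles of vertex and edge are exchanged here.
        same-edge eq = agree-across (λ e v → flag-injective v e) eq (distinct f λ ())
          (swap (near 0F 2F)) (swap (near 1F 2F))
    in case near 0F 1F of λ where
      (inj₁ eq) → case pigeonhole (n<1+n 3) (rank ∘ map f) of λ where
        (i , j , i<j , ranks) → distinct f (<⇒≢ i<j)
          (rank-injective (trans (sym (same-vertex eq i)) (same-vertex eq j)) ranks)
      (inj₂ eq) → case two-ends eq (same-edge eq) of λ where
        (inj₁ 01≡)        → distinct f (λ ()) 01≡
        (inj₂ (inj₁ 02≡)) → distinct f (λ ()) 02≡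
        (inj₂ (inj₂ 12≡)) → distinct f (λ ()) 12≡

  -- The element shared by the two isolated vertices also belongs to both ends of the edge, which
  -- therefore share it.
  co-diamond-free : co-diamond -Free graph
  co-diamond-free = ↪-free λ f →
    contradict (preserve f (from-yes (adj? co-diamond 0F 1F)))
      (distinct f λ ())
      (share f 2F 3F (from-no (adj? co-diamond 2F 3F)))
      (share f 2F 0F (from-no (adj? co-diamond 2F 0F)))
      (share f 3F 0F (from-no (adj? co-diamond 3F 0F)))
      (share f 2F 1F (from-no (adj? co-diamond 2F 1F)))
      (share f 3F 1F (from-no (adj? co-diamond 3F 1F)))
    where
    contradict : ∀ {x y c d} → Adj graph x y → c ≢ d → Share c d →
      Share c x → Share d x → Share c y → Share d y → ⊥
    contradict xy c≢d (inj₁ cd) cx dx cy dy = xy (inj₁ (trans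
      (sym (agree-across flag-injective cd c≢d cx dx))
      (agree-across flag-injective cd c≢d cy dy)))
    contradict xy c≢d (inj₂ cd) cx dx cy dy = xy (inj₂ (trans
      (sym (agree-across edge-first cd c≢d (swap cx) (swap dx)))
      (agree-across edge-first cd c≢d (swap cy) (swap dy))))
      where
      edge-first : ∀ {a b} → edge a ≡ edge b → vertex a ≡ vertex b → a ≡ b
      edge-first e v = flag-injective v e

  co-claw-free : co-claw -Free graph
  co-claw-free = ↪-free λ f →
    contradict (preserve f (from-yes (adj? co-claw 0F 1F)))
      (preserve f (from-yes (adj? co-claw 0F 2F)))
      (preserve f (from-yes (adj? co-claw 1F 2F)))
      (share f 3F 0F (from-no (adj? co-claw 3F 0F)))
      (share f 3F 1F (from-no (adj? co-claw 3F 1F)))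
      (share f 3F 2F (from-no (adj? co-claw 3F 2F)))
    where
    contradict : ∀ {x y z c} → Adj graph x y → Adj graph x z → Adj graph y z →
      Share c x → Share c y → Share c z → ⊥
    contradict xy xz yz (inj₁ cx) (inj₁ cy) _         = xy (inj₁ (trans (sym cx) cy))
    contradict xy xz yz (inj₂ cx) (inj₂ cy) _         = xy (inj₂ (trans (sym cx) cy))
    contradict xy xz yz (inj₁ cx) (inj₂ _)  (inj₁ cz) = xz (inj₁ (trans (sym cx) cz))
    contradict xy xz yz (inj₁ _)  (inj₂ cy) (inj₂ cz) = yz (inj₂ (trans (sym cy) cz))
    contradict xy xz yz (inj₂ _)  (inj₁ cy) (inj₁ cz) = yz (inj₁ (trans (sym cy) cz))
    contradict xy xz yz (inj₂ cx) (inj₁ _)  (inj₂ cz) = xz (inj₂ (trans (sym cx) cz))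

  -- The two colorings

  vertex-coloring : ∀ {j} → k ≤ j → Coloring graph j
  vertex-coloring k≤j = coloring (λ v → inject≤ (vertex v) k≤j)
    λ uv eq → uv (inj₁ (inject≤-injective k≤j k≤j _ _ eq))

  edge-coloring : Coloring graph ℓ
  edge-coloring = coloring edge λ uv eq → uv (inj₂ eq)

  edge-coloring-frozen : Frozen edge-coloring
  edge-coloring-frozen v e e≢ with u , refl , u≢v ← other-end v e =
    u , (λ where (inj₁ eq) → u≢v (sym eq)
                 (inj₂ eq) → e≢ (trans (sym eq) (sym (lookup∘tabulate edge v))))
      , lookup∘tabulate edge u

  -- Two distinct flags at one vertex tell the colorings apart: naming by vertex identifies them,
  -- naming by edge does not.
  not-mixing : k ≤ ℓ → ∀ {a b} → vertex a ≡ vertex b → a ≢ b → ¬ (ℓ -Mixing graph)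
  not-mixing k≤ℓ {a} {b} ab a≢b =
    frozen-not-mixing {c = edge-coloring} {d = vertex-coloring k≤ℓ} edge-coloring-frozen
      λ eq → a≢b (flag-injective ab (begin
        edge a                        ≡⟨ lookup∘tabulate edge a ⟨
        color edge-coloring a         ≡⟨ cong (λ c → color c a) eq ⟩
        color (vertex-coloring k≤ℓ) a ≡⟨ lookup∘tabulate _ a ⟩
        inject≤ (vertex a) k≤ℓ        ≡⟨ cong (λ x → inject≤ x k≤ℓ) ab ⟩
        inject≤ (vertex b) k≤ℓ        ≡⟨ lookup∘tabulate _ b ⟨
        color (vertex-coloring k≤ℓ) b ≡⟨ cong (λ c → color c b) eq ⟨
        color edge-coloring b         ≡⟨ lookup∘tabulate edge b ⟩
        edge b                        ∎))
    where open ≡-Reasoning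

-- Flags of disjoint copies of K₄

K₄-flags : Flags 12 4 6
K₄-flags = record
  { vertex = vertex
  ; edge   = edge
  ; rank   = rank
  ; flag-injective = λ {a} {b} → from-yes
      (all? λ a → all? λ b → vertex a ≟ vertex b →-dec edge a ≟ edge b →-dec a ≟ b) a b
  ; rank-injective = λ {a} {b} → from-yes
      (all? λ a → all? λ b → vertex a ≟ vertex b →-dec rank a ≟ rank b →-dec a ≟ b) a b
  ; two-ends = λ {a} {b} {c} ab → from-yes
      (all? λ a → all? λ b → edge a ≟ edge b →-dec all? λ c → edge a ≟ edge c →-dec
        (a ≟ b ⊎-dec a ≟ c ⊎-dec b ≟ c)) a b ab c
  -- Each hypothesis precedes the next quantifier, which prunes the exhaustive check over
  -- quadruples.
  ; no-digon = λ {a} {b} {c} {d} ab bc → from-yes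
      (all? λ a → all? λ b → vertex a ≟ vertex b →-dec all? λ c → edge b ≟ edge c →-dec
        all? λ d → vertex c ≟ vertex d →-dec edge d ≟ edge a →-dec
          (a ≟ b ⊎-dec vertex a ≟ vertex c)) a b ab c bc d
  ; other-end = from-yes
      (all? λ a → all? λ e → any? λ u → edge u ≟ e ×-dec ¬? (vertex u ≟ vertex a))
  }
  where
  vertex : Fin 12 → Fin 4
  vertex = quotient 3

  rank : Fin 12 → Fin 3
  rank = remainder {4} 3

  edge : Fin 12 → Fin 6
  -- Row `v` lists the edges at vertex `v`; the edges 0 to 5 are 01, 02, 03, 12, 13, 23.
  edge = lookup (0F ∷ 1F ∷ 2F ∷
                 0F ∷ 3F ∷ 4F ∷
                 1F ∷ 3F ∷ 5F ∷
                 2F ∷ 4F ∷ 5F ∷ [])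

module _ (p : ℕ) {n : ℕ} where

  copywise : ∀ {k} → (Fin n → Fin k) → Fin (p * n) → Fin (p * k)
  copywise f v = combine (quotient {p} n v) (f (remainder {p} n v))

  copywise-combine : ∀ {k} (f : Fin n → Fin k) i a →
    copywise f (combine i a) ≡ combine i (f a)
  copywise-combine f i a = cong (λ (j , b) → combine j (f b)) (remQuot-combine {p} i a)

  copywise-injective : ∀ {k} (f : Fin n → Fin k) {u v} → copywise f u ≡ copywise f v →
    quotient {p} n u ≡ quotient {p} n v × f (remainder {p} n u) ≡ f (remainder {p} n v)
  copywise-injective {k} f = combine-injective {p} {k} _ _ _ _

  from-parts : ∀ {u v} → quotient {p} n u ≡ quotient {p} n v →
    remainder {p} n u ≡ remainder {p} n v → u ≡ v
  from-parts {u} {v} q r = trans (sym (combine-remQuot {p} n u))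
    (trans (cong₂ combine q r) (combine-remQuot {p} n v))

-- Flags with a common vertex or edge lie in the same copy, so each condition except `other-end`
-- reduces to a single copy.
copies : ∀ p {n k ℓ} → Flags n k ℓ → Flags (p * n) (p * k) (p * ℓ)
copies p {n} {k} {ℓ} F = record
  { vertex = copywise p vertex
  ; edge   = copywise p edge
  ; rank   = rank ∘ remainder {p} n
  ; flag-injective = λ v e →
      let q , v₀ = copywise-injective p vertex v
          _ , e₀ = copywise-injective p edge e
      in from-parts p q (flag-injective v₀ e₀)
  ; rank-injective = λ v r →
      let q , v₀ = copywise-injective p vertex v
      in from-parts p q (rank-injective v₀ r)
  ; two-ends = λ ab ac →
      let qab , ab₀ = copywise-injective p edge ab
          qac , ac₀ = copywise-injective p edge ac
      in map₃ (from-parts p qab) (from-parts p qac) (from-parts p (trans (sym qab) qac))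
           (two-ends ab₀ ac₀)
  ; no-digon = λ ab bc cd da →
      let qab , ab₀ = copywise-injective p vertex ab
          qbc , bc₀ = copywise-injective p edge bc
          _   , cd₀ = copywise-injective p vertex cd
          _   , da₀ = copywise-injective p edge da
      in Sum.map (from-parts p qab) (cong₂ combine (trans qab qbc)) (no-digon ab₀ bc₀ cd₀ da₀)
  -- The flag is chosen in the copy of `e`, possibly not that of `a`; its vertex already differs
  -- from that of `a` in the position within a copy.
  ; other-end = λ a e →
      let j , e₀ = remQuot {p} ℓ e
          u₀ , e≡ , v≢ = other-end (remainder {p} n a) e₀
      in combine j u₀
       , trans (copywise-combine p edge j u₀)
           (trans (cong (combine j) e≡) (combine-remQuot {p} ℓ e))
       , λ eq → v≢ (proj₂ (combine-injective {p} {k} _ _ _ _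
           (trans (sym (copywise-combine p vertex j u₀)) eq)))
  }
  where
  open Flags F

  map₃ : {A B C A′ B′ C′ : Set} → (A → A′) → (B → B′) → (C → C′) → A ⊎ B ⊎ C → A′ ⊎ B′ ⊎ C′
  map₃ f g h = Sum.map f (Sum.map g h)

theorem3 : (H : FiniteGraph 4) → H ∈ (4K₁ ∷ co-diamond ∷ co-claw ∷ []) →
    (p : ℕ) → p ≥ 1 →
    ∃[ k ] (k ≥ 1 × (∃[ n ] (Σ[ G ∈ FiniteGraph n ]
    ((k -Colorable G) × (2K₂ -Free G) × (H -Free G) × (¬ ((k + p) -Mixing G))))))
theorem3 H H∈ p@(suc _) p≥1 =
  p * 5 , s≤s z≤n , p * 12 , graph ,
  vertex-coloring (*-monoʳ-≤ p (n≤1+n 4)) , 2K₂-free , H-free H∈ ,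
  subst (λ ℓ → ¬ (ℓ -Mixing graph)) (trans (*-suc p 5) (+-comm p (p * 5)))
    -- As `p` is a successor there is a first copy, and its flags `0F` and `1F` lie at the same
    -- vertex.
    (not-mixing (*-monoʳ-≤ p (m≤m+n 4 2)) {0F} {1F} refl λ ())
  where
  open FlagGraph (copies p K₄-flags)

  H-free : ∀ {H} → H ∈ (4K₁ ∷ co-diamond ∷ co-claw ∷ []) → H -Free graph
  H-free (here refl)                 = 4K₁-free
  H-free (there (here refl))         = co-diamond-free
  H-free (there (there (here refl))) = co-claw-free
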